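{- Let $\Bbbk$ be a nonzero commutative ring. Let $A$ be a precise artinian local ring in $\mathsf{STRing}_{\mathrm{c}}\,\Bbbk$, with residue field $K$. Give $K$ the fine $A$-module topology. Then any lifting $\sigma:K\to A$ in $\mathsf{STRing}_{\mathrm{c}}\,\Bbbk$ is a precise lifting.
   Context: $\Bbbk$ carries the discrete topology. A $\Bbbk$-linear topology on a $\Bbbk$-module is a module topology in which $0$ has a basis of open neighborhoods consisting of $\Bbbk$-submodules. A commutative semi-topological (ST) $\Bbbk$-ring is a commutative $\Bbbk$-ring $A$ with a $\Bbbk$-linear topology such that for every $a\in A$ the map $A\to A$, $b\mapsto ab$, is continuous. These form the category $\mathsf{STRing}_{\mathrm{c}}\,\Bbbk$, with morphisms the continuous $\Bbbk$-ring homomorphisms. A ST $A$-module is an $A$-module $M$ with a $\Bbbk$-linear topology such that for every $a\in A$, $m\in M$ the maps $M\to M$, $m'\mapsto am'$, and $A\to M$, $a'\mapsto a'm$, are continuous. The fine $A$-module topology on an $A$-module is the finest $\Bbbk$-linear topology making it a ST $A$-module (it exists). Given a ring homomorphism $f:A\to B$ and a $B$-module $M$, the fine $(A,f)$-module topology on $M$ is the fine $A$-module topology on $M$ viewed as an $A$-module via $f$. Let $A$ be an artinian local ring in $\mathsf{STRing}_{\mathrm{c}}\,\Bbbk$ with residue field $K$, with $K$ given the fine $A$-module topology, and let $\pi:A\to K$ be the canonical surjection. A lifting is a continuous $\Bbbk$-ring homomorphism $\sigma:K\to A$ with $\pi\circ\sigma=\mathrm{id}_K$. The lifting $\sigma$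 is precise if the given topology of $A$ equals the fine $(K,\sigma)$-module topology on $A$. $A$ is a precise artinian local ring in $\mathsf{STRing}_{\mathrm{c}}\,\Bbbk$ if it admits some precise lifting. -}

module Defs where

open import Level using (Level; suc; Lift; lift; lower)
open import Algebra.Bundles using (CommutativeRing)
open import Algebra.Module.Bundles using (Module)
open import Algebra.Module.Construct.TensorUnit using (⟨module⟩)
open import Algebra.Morphism.Structures using (IsRingHomomorphism)
open import Algebra.Morphism.Construct.Composition using (isRingHomomorphism)
import Algebra.Properties.Ring as RingProperties
open import Data.Nat.Base using (ℕ) renaming (suc to 1+_; _≤_ to _≤ℕ_)
open import Data.Product.Base using (Σ; Σ-syntax; ∃; ∃-syntax; _×_; _,_; proj₁; proj₂; uncurry)
open import Data.Product.Relation.Binary.Pointwise.NonDependent using (×-setoid)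
open import Data.Unit.Polymorphic.Base using (⊤; tt)
open import Relation.Binary.Bundles using (Setoid)
open import Relation.Binary.Definitions using (_Respects_)
import Relation.Binary.Reasoning.Setoid as SetoidReasoning
open import Relation.Nullary.Negation.Core using (¬_)
open import Relation.Unary using (Pred; _∈_; _∉_; _⊆_; _≐_; _∩_; _⊢_; _⟨×⟩_; ⋃)

------------------------------------------------------------------------
-- Topologies

-- The points of the space are the ≈-classes of the setoid, so open sets are
-- required to respect _≈_, and openness depends only on the extension of a
-- predicate.

record Topology {u : Level} (X : Setoid u u) : Set (suc (suc u)) where
  open Setoid X using (Carrier; _≈_)
  field
    IsOpen        : Pred (Pred Carrier u) (suc u)
    open-resp-≈   : ∀ {U} → IsOpen U → U Respects _≈_
    open-resp-≐   : ∀ {U V} → U ≐ V → IsOpen U → IsOpen V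
    open-whole    : IsOpen (λ _ → ⊤)
    open-∩        : ∀ {U V} → IsOpen U → IsOpen V → IsOpen (U ∩ V)
    open-⋃        : (I : Set u) (F : I → Pred Carrier u) →
                    (∀ i → IsOpen (F i)) → IsOpen (⋃ I F)

open Topology public using (IsOpen)

Continuous : {u : Level} {X Y : Setoid u u} → Topology X → Topology Y →
             (Setoid.Carrier X → Setoid.Carrier Y) → Set (suc u)
Continuous τ τ′ f = ∀ {U} → IsOpen τ′ U → IsOpen τ (f ⊢ U)

FinerThan : {u : Level} {X : Setoid u u} → Topology X → Topology X → Set (suc u)
FinerThan τ τ′ = ∀ {U} → IsOpen τ′ U → IsOpen τ U

discrete : {u : Level} (X : Setoid u u) → Topology X
discrete {u} X = record
  { IsOpen      = λ U → Lift (suc u) (U Respects _≈_)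
  ; open-resp-≈ = λ oU → lower oU
  ; open-resp-≐ = λ (U⊆V , V⊆U) oU → lift λ x≈y x∈V → U⊆V (lower oU x≈y (V⊆U x∈V))
  ; open-whole  = lift λ _ _ → tt
  ; open-∩      = λ oU oV → lift λ x≈y (x∈U , x∈V) → lower oU x≈y x∈U , lower oV x≈y x∈V
  ; open-⋃      = λ I F oF → lift λ x≈y (i , x∈Fi) → i , lower (oF i) x≈y x∈Fi
  }
  where open Setoid X using (_≈_)

infixr 2 _×ᵗ_

_×ᵗ_ : {u : Level} {X Y : Setoid u u} →
       Topology X → Topology Y → Topology (×-setoid X Y)
_×ᵗ_ {u} {X} {Y} τ τ′ = record
  { IsOpen      = Open
  ; open-resp-≈ = λ oW (x≈x′ , y≈y′) p∈W →
      let (U , V , oU , oV , (x∈U , y∈V) , UV⊆W) = oW p∈W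
      in UV⊆W (Topology.open-resp-≈ τ oU x≈x′ x∈U , Topology.open-resp-≈ τ′ oV y≈y′ y∈V)
  ; open-resp-≐ = λ (W⊆W′ , W′⊆W) oW p∈W′ →
      let (U , V , oU , oV , p∈UV , UV⊆W) = oW (W′⊆W p∈W′)
      in U , V , oU , oV , p∈UV , λ q → W⊆W′ (UV⊆W q)
  ; open-whole  = λ _ → (λ _ → ⊤) , (λ _ → ⊤)
      , Topology.open-whole τ , Topology.open-whole τ′ , (tt , tt) , λ _ → tt
  ; open-∩      = λ oW oW′ (p∈W , p∈W′) →
      let (U  , V  , oU  , oV  , (x∈U  , y∈V ) , UV⊆W ) = oW p∈W
          (U′ , V′ , oU′ , oV′ , (x∈U′ , y∈V′) , UV⊆W′) = oW′ p∈W′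
      in U ∩ U′ , V ∩ V′ , Topology.open-∩ τ oU oU′ , Topology.open-∩ τ′ oV oV′
         , ((x∈U , x∈U′) , (y∈V , y∈V′))
         , λ ((a , a′) , (b , b′)) → UV⊆W (a , b) , UV⊆W′ (a′ , b′)
  ; open-⋃      = λ I F oF (i , p∈Fi) →
      let (U , V , oU , oV , p∈UV , UV⊆Fi) = oF i p∈Fi
      in U , V , oU , oV , p∈UV , λ q → i , UV⊆Fi q
  }
  where
  Open : Pred (Pred (Setoid.Carrier (×-setoid X Y)) u) (suc u)
  Open W = ∀ {p} → p ∈ W →
    Σ[ U ∈ Pred (Setoid.Carrier X) u ] Σ[ V ∈ Pred (Setoid.Carrier Y) u ]
      IsOpen τ U × IsOpen τ′ V × p ∈ (U ⟨×⟩ V) × (U ⟨×⟩ V) ⊆ W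

------------------------------------------------------------------------
-- Modules, ideals, quotient rings

IsHom : {u : Level} (A B : CommutativeRing u u) →
        (CommutativeRing.Carrier A → CommutativeRing.Carrier B) → Set u
IsHom A B = IsRingHomomorphism (CommutativeRing.rawRing A) (CommutativeRing.rawRing B)

restrict : {u : Level} (A B : CommutativeRing u u)
           (f : CommutativeRing.Carrier A → CommutativeRing.Carrier B) →
           IsHom A B f → Module B u u → Module A u u
restrict A B f f-hom M = record
  { Carrierᴹ = Carrierᴹ
  ; _≈ᴹ_     = _≈ᴹ_
  ; _+ᴹ_     = _+ᴹ_
  ; _*ₗ_     = λ a m → f a *ₗ m
  ; _*ᵣ_     = λ m a → m *ᵣ f a
  ; 0ᴹ       = 0ᴹ
  ; -ᴹ_      = -ᴹ_
  ; isModule = record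
    { isBimodule = record
      { isBisemimodule = record
        { +ᴹ-isCommutativeMonoid = +ᴹ-isCommutativeMonoid
        ; isPreleftSemimodule = record
          { *ₗ-cong      = λ a≈b → *ₗ-cong (F.⟦⟧-cong a≈b)
          ; *ₗ-zeroˡ     = λ m → ≈ᴹ-trans (*ₗ-congʳ F.0#-homo) (*ₗ-zeroˡ m)
          ; *ₗ-distribʳ  = λ m a b → ≈ᴹ-trans (*ₗ-congʳ (F.+-homo a b)) (*ₗ-distribʳ m (f a) (f b))
          ; *ₗ-identityˡ = λ m → ≈ᴹ-trans (*ₗ-congʳ F.1#-homo) (*ₗ-identityˡ m)
          ; *ₗ-assoc     = λ a b m → ≈ᴹ-trans (*ₗ-congʳ (F.*-homo a b)) (*ₗ-assoc (f a) (f b) m)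
          ; *ₗ-zeroʳ     = λ a → *ₗ-zeroʳ (f a)
          ; *ₗ-distribˡ  = λ a → *ₗ-distribˡ (f a)
          }
        ; isPrerightSemimodule = record
          { *ᵣ-cong      = λ m≈n a≈b → *ᵣ-cong m≈n (F.⟦⟧-cong a≈b)
          ; *ᵣ-zeroʳ     = λ m → ≈ᴹ-trans (*ᵣ-congˡ F.0#-homo) (*ᵣ-zeroʳ m)
          ; *ᵣ-distribˡ  = λ m a b → ≈ᴹ-trans (*ᵣ-congˡ (F.+-homo a b)) (*ᵣ-distribˡ m (f a) (f b))
          ; *ᵣ-identityʳ = λ m → ≈ᴹ-trans (*ᵣ-congˡ F.1#-homo) (*ᵣ-identityʳ m)
          ; *ᵣ-assoc     = λ m a b → ≈ᴹ-trans (*ᵣ-assoc m (f a) (f b)) (*ᵣ-congˡ (CommutativeRing.sym B (F.*-homo a b)))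
          ; *ᵣ-zeroˡ     = λ a → *ᵣ-zeroˡ (f a)
          ; *ᵣ-distribʳ  = λ a → *ᵣ-distribʳ (f a)
          }
        ; *ₗ-*ᵣ-assoc = λ a m b → *ₗ-*ᵣ-assoc (f a) m (f b)
        }
      ; -ᴹ‿cong    = -ᴹ‿cong
      ; -ᴹ‿inverse = -ᴹ‿inverse
      }
    ; *ₗ-*ᵣ-coincident = λ a m → *ₗ-*ᵣ-coincident (f a) m
    }
  }
  where
  open Module M
  module F = IsRingHomomorphism f-hom

record IsSubmodule {u : Level} {R : CommutativeRing u u} (M : Module R u u)
                   (N : Pred (Module.Carrierᴹ M) u) : Set u where
  open Module M
  field
    resp-≈    : N Respects _≈ᴹ_
    0∈        : 0ᴹ ∈ N
    +-closed  : ∀ {x y} → x ∈ N → y ∈ N → (x +ᴹ y) ∈ N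
    *ₗ-closed : ∀ r {x} → x ∈ N → (r *ₗ x) ∈ N

IsIdeal : {u : Level} (A : CommutativeRing u u) → Pred (CommutativeRing.Carrier A) u → Set u
IsIdeal A = IsSubmodule (⟨module⟩ {R = A})

IsNonzero : {u : Level} → CommutativeRing u u → Set u
IsNonzero R = ¬ (1# ≈ 0#)
  where open CommutativeRing R

IsProperIdeal : {u : Level} (A : CommutativeRing u u) → Pred (CommutativeRing.Carrier A) u → Set u
IsProperIdeal A I = IsIdeal A I × CommutativeRing.1# A ∉ I

IsMaximalIdeal : {u : Level} (A : CommutativeRing u u) → Pred (CommutativeRing.Carrier A) u → Set (suc u)
IsMaximalIdeal A I = IsProperIdeal A I × (∀ J → IsProperIdeal A J → I ⊆ J → J ⊆ I)

record IsLocal {u : Level} (A : CommutativeRing u u) : Set (suc u) where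
  field
    𝔪           : Pred (CommutativeRing.Carrier A) u
    𝔪-isMaximal : IsMaximalIdeal A 𝔪
    𝔪-unique    : ∀ J → IsMaximalIdeal A J → J ≐ 𝔪

  𝔪-isIdeal : IsIdeal A 𝔪
  𝔪-isIdeal = proj₁ (proj₁ 𝔪-isMaximal)

IsArtinian : {u : Level} → CommutativeRing u u → Set (suc u)
IsArtinian {u} A =
  ∀ (I : ℕ → Pred (CommutativeRing.Carrier A) u) → (∀ n → IsIdeal A (I n)) →
  (∀ n → I (1+ n) ⊆ I n) → ∃[ n ] (∀ m → n ≤ℕ m → I n ≐ I m)

-- The quotient has the same carrier, with x and y identified when x - y ∈ I;
-- the canonical surjection is therefore the identity function on carriers.

module Quotient {u : Level} (A : CommutativeRing u u)
                (I : Pred (CommutativeRing.Carrier A) u) (I-ideal : IsIdeal A I) where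
  open CommutativeRing A
  open RingProperties ring
  open IsSubmodule I-ideal
  open SetoidReasoning setoid

  private
    infix 4 _∼_
    _∼_ : Carrier → Carrier → Set u
    x ∼ y = (x - y) ∈ I

    ≈⇒∼ : ∀ {x y} → x ≈ y → x ∼ y
    ≈⇒∼ {x} {y} x≈y = resp-≈ (sym (trans (+-congʳ x≈y) (-‿inverseʳ y))) 0∈

    neg : ∀ {x} → x ∈ I → (- x) ∈ I
    neg {x} x∈I = resp-≈ (-1*x≈-x x) (*ₗ-closed (- 1#) x∈I)

    swap : ∀ x y → - (x - y) ≈ y - x
    swap x y = begin
      - (x - y)     ≈⟨ -‿+-comm x (- y) ⟨
      - x + - - y   ≈⟨ +-congˡ (-‿involutive y) ⟩
      - x + y       ≈⟨ +-comm (- x) y ⟩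
      y - x         ∎

    telescope : ∀ x y z → (x - y) + (y - z) ≈ x - z
    telescope x y z = begin
      (x - y) + (y - z)     ≈⟨ +-assoc x (- y) (y - z) ⟩
      x + (- y + (y - z))   ≈⟨ +-congˡ (+-assoc (- y) y (- z)) ⟨
      x + ((- y + y) - z)   ≈⟨ +-congˡ (+-congʳ (-‿inverseˡ y)) ⟩
      x + (0# - z)          ≈⟨ +-congˡ (+-identityˡ (- z)) ⟩
      x - z                 ∎

    ∼-sym : ∀ {x y} → x ∼ y → y ∼ x
    ∼-sym {x} {y} x∼y = resp-≈ (swap x y) (neg x∼y)

    ∼-trans : ∀ {x y z} → x ∼ y → y ∼ z → x ∼ z
    ∼-trans {x} {y} {z} x∼y y∼z = resp-≈ (telescope x y z) (+-closed x∼y y∼z)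

    +-∼ˡ : ∀ z {x y} → x ∼ y → z + x ∼ z + y
    +-∼ˡ z {x} {y} = resp-≈ (sym (begin
      (z + x) - (z + y)       ≈⟨ +-congʳ (+-comm z x) ⟩
      (x + z) - (z + y)       ≈⟨ +-congˡ (-‿+-comm z y) ⟨
      (x + z) + (- z - y)     ≈⟨ +-congʳ (+-congˡ (-‿involutive z)) ⟨
      (x - - z) + (- z - y)   ≈⟨ telescope x (- z) y ⟩
      x - y                   ∎))

    *-∼ˡ : ∀ z {x y} → x ∼ y → z * x ∼ z * y
    *-∼ˡ z {x} {y} x∼y = resp-≈ (x[y-z]≈xy-xz z x y) (*ₗ-closed z x∼y)

    +-∼ : ∀ {x y z w} → x ∼ y → z ∼ w → x + z ∼ y + w
    +-∼ {x} {y} {z} {w} x∼y z∼w = ∼-trans (+-∼ˡ x z∼w)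
      (∼-trans (≈⇒∼ (+-comm x w)) (∼-trans (+-∼ˡ w x∼y) (≈⇒∼ (+-comm w y))))

    *-∼ : ∀ {x y z w} → x ∼ y → z ∼ w → x * z ∼ y * w
    *-∼ {x} {y} {z} {w} x∼y z∼w = ∼-trans (*-∼ˡ x z∼w)
      (∼-trans (≈⇒∼ (*-comm x w)) (∼-trans (*-∼ˡ w x∼y) (≈⇒∼ (*-comm w y))))

    -‿∼ : ∀ {x y} → x ∼ y → - x ∼ - y
    -‿∼ {x} {y} x∼y = resp-≈ (sym (-‿+-comm x (- y))) (neg x∼y)

  quotientRing : CommutativeRing u u
  quotientRing = record
    { Carrier = Carrier
    ; _≈_     = _∼_
    ; _+_     = _+_
    ; _*_     = _*_
    ; -_      = -_
    ; 0#      = 0#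
    ; 1#      = 1#
    ; isCommutativeRing = record
      { isRing = record
        { +-isAbelianGroup = record
          { isGroup = record
            { isMonoid = record
              { isSemigroup = record
                { isMagma = record
                  { isEquivalence = record { refl = ≈⇒∼ refl ; sym = ∼-sym ; trans = ∼-trans }
                  ; ∙-cong        = +-∼
                  }
                ; assoc = λ x y z → ≈⇒∼ (+-assoc x y z)
                }
              ; identity = (λ x → ≈⇒∼ (+-identityˡ x)) , (λ x → ≈⇒∼ (+-identityʳ x))
              }
            ; inverse = (λ x → ≈⇒∼ (-‿inverseˡ x)) , (λ x → ≈⇒∼ (-‿inverseʳ x))
            ; ⁻¹-cong = -‿∼
            }
          ; comm = λ x y → ≈⇒∼ (+-comm x y)
          }
        ; *-cong     = *-∼
        ; *-assoc    = λ x y z → ≈⇒∼ (*-assoc x y z)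
        ; *-identity = (λ x → ≈⇒∼ (*-identityˡ x)) , (λ x → ≈⇒∼ (*-identityʳ x))
        ; distrib    = (λ x y z → ≈⇒∼ (distribˡ x y z)) , (λ x y z → ≈⇒∼ (distribʳ x y z))
        }
      ; *-comm = λ x y → ≈⇒∼ (*-comm x y)
      }
    }

  π : Carrier → Carrier
  π x = x

  π-isHom : IsHom A quotientRing π
  π-isHom = record
    { isSemiringHomomorphism = record
      { isNearSemiringHomomorphism = record
        { +-isMonoidHomomorphism = record
          { isMagmaHomomorphism = record
            { isRelHomomorphism = record { cong = ≈⇒∼ }
            ; homo              = λ _ _ → ≈⇒∼ refl
            }
          ; ε-homo = ≈⇒∼ refl
          }
        ; *-homo = λ _ _ → ≈⇒∼ refl
        }
      ; 1#-homo = ≈⇒∼ refl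
      }
    ; -‿homo = λ _ → ≈⇒∼ refl
    }

------------------------------------------------------------------------
-- Linear topologies, ST rings and ST modules

-- The base ring carries the discrete topology.

record IsLinearTopology {u : Level} {𝕜 : CommutativeRing u u} (M : Module 𝕜 u u)
                        (τ : Topology (Module.≈ᴹ-setoid M)) : Set (suc u) where
  open Module M
  field
    +-continuous  : Continuous (τ ×ᵗ τ) τ (uncurry _+ᴹ_)
    *ₗ-continuous : Continuous (discrete (CommutativeRing.setoid 𝕜) ×ᵗ τ) τ (uncurry _*ₗ_)
    submodule-basis : ∀ {U} → IsOpen τ U → 0ᴹ ∈ U →
                      Σ[ N ∈ Pred Carrierᴹ u ] IsSubmodule M N × IsOpen τ N × N ⊆ U

record STRing {u : Level} (𝕜 : CommutativeRing u u) : Set (suc (suc u)) where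
  field
    ring : CommutativeRing u u

  open CommutativeRing ring using (Carrier; setoid; _*_)

  field
    structureMap       : CommutativeRing.Carrier 𝕜 → Carrier
    structureMap-isHom : IsHom 𝕜 ring structureMap
    topology           : Topology setoid
    isLinear           : IsLinearTopology (restrict 𝕜 ring structureMap structureMap-isHom (⟨module⟩ {R = ring})) topology
    *-continuous       : ∀ a → Continuous topology topology (a *_)

record STHom {u : Level} {𝕜 : CommutativeRing u u} (A B : STRing 𝕜) : Set (suc u) where
  private
    module A = STRing A
    module B = STRing B
  field
    ⟦_⟧        : CommutativeRing.Carrier A.ring → CommutativeRing.Carrier B.ring
    isHom      : IsHom A.ring B.ring ⟦_⟧
    𝕜-linear   : ∀ c → CommutativeRing._≈_ B.ring ⟦ A.structureMap c ⟧ (B.structureMap c)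
    continuous : Continuous A.topology B.topology ⟦_⟧

record IsSTModule {u : Level} {𝕜 : CommutativeRing u u} (A : STRing 𝕜)
                  (M : Module (STRing.ring A) u u)
                  (τ : Topology (Module.≈ᴹ-setoid M)) : Set (suc u) where
  open STRing A
  open Module M
  field
    isLinearᴹ      : IsLinearTopology (restrict 𝕜 ring structureMap structureMap-isHom M) τ
    *ₗ-continuousʳ : ∀ a → Continuous τ τ (λ m → a *ₗ m)
    *ₗ-continuousˡ : ∀ m → Continuous topology τ (λ a → a *ₗ m)

IsFineTopology : {u : Level} {𝕜 : CommutativeRing u u} (A : STRing 𝕜)
                 (M : Module (STRing.ring A) u u) →
                 Topology (Module.≈ᴹ-setoid M) → Set (suc (suc u))
IsFineTopology A M τ = IsSTModule A M τ × (∀ τ′ → IsSTModule A M τ′ → FinerThan τ τ′)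

------------------------------------------------------------------------
-- Liftings

module Residue {u : Level} {𝕜 : CommutativeRing u u} (A : STRing 𝕜)
               (local : IsLocal (STRing.ring A)) where
  open STRing A
  open IsLocal local
  open Quotient ring 𝔪 𝔪-isIdeal public
    renaming (quotientRing to K)

  K-asModule : Module ring u u
  K-asModule = restrict ring K π π-isHom (⟨module⟩ {R = K})

  IsFineOnK : Topology (CommutativeRing.setoid K) → Set (suc (suc u))
  IsFineOnK = IsFineTopology A K-asModule

module Liftings {u : Level} {𝕜 : CommutativeRing u u} (A : STRing 𝕜)
                (local : IsLocal (STRing.ring A))
                (τK : Topology (CommutativeRing.setoid (Residue.K A local)))
                (fine : Residue.IsFineOnK A local τK) where
  open STRing A
  open Residue A local

  private
    module S = IsSTModule {𝕜 = 𝕜} {A = A} {M = K-asModule} {τ = τK} (proj₁ fine)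
    module L = IsLinearTopology {𝕜 = 𝕜} {M = restrict 𝕜 ring structureMap structureMap-isHom K-asModule}
                                {τ = τK} S.isLinearᴹ

  -- Multiplication by a class in K is continuous because it is multiplication
  -- by any representative of it in A.

  ST-K : STRing 𝕜
  ST-K = record
    { ring               = K
    ; structureMap       = λ c → π (structureMap c)
    ; structureMap-isHom = isRingHomomorphism (CommutativeRing.trans K) structureMap-isHom π-isHom
    ; topology           = τK
    ; isLinear           = record
      { +-continuous    = L.+-continuous
      ; *ₗ-continuous   = L.*ₗ-continuous
      ; submodule-basis = λ oU 0∈U →
          let (N , N-sub , oN , N⊆U) = L.submodule-basis oU 0∈U
              module N = IsSubmodule N-sub
          in N , record { resp-≈ = N.resp-≈ ; 0∈ = N.0∈ ; +-closed = N.+-closed ; *ₗ-closed = N.*ₗ-closed }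
             , oN , N⊆U
      }
    ; *-continuous       = S.*ₗ-continuousʳ
    }

  record Lifting : Set (suc u) where
    field
      hom     : STHom ST-K A
    open STHom hom public
    field
      section : ∀ k → CommutativeRing._≈_ K (π ⟦ k ⟧) k

  IsPrecise : Lifting → Set (suc (suc u))
  IsPrecise σ = IsFineTopology ST-K (restrict K ring ⟦_⟧ isHom (⟨module⟩ {R = ring})) topology
    where open Lifting σ

-- Let σ₀ be a precise lifting, and let τ′ be any ST module topology on A viewed
-- as a K-module via σ.  Among the ideals I such that U + I is open in A for
-- every subgroup U open in the join of τ′ and the given topology, and such that
-- A has a σ₀-linear retraction q onto I, take a minimal one.  If I ≠ 0, there
-- are an ideal I′ ⊂ I and b ∈ I with I/I′ = Kb, and q followed by I → I/I′ is a
-- σ₀-linear functional φ : A → K, hence continuous because σ₀ is precise.  On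
-- I/I′ the liftings σ and σ₀ act alike, so { x | σ(φ(x)) b ∈ U + I′ } is open
-- and meets I inside U + I′; this makes U + I′ open and contradicts the
-- minimality of I.  Hence I = 0, and every τ′-open set is open in A.

module Submission where

open import Defs
open import Level using (Level)
open import Algebra.Bundles using (CommutativeRing; Group; RawGroup)
open import Algebra.Module.Bundles using (Module)
open import Algebra.Module.Construct.TensorUnit using (⟨module⟩)
open import Algebra.Morphism.Structures using (IsRingHomomorphism)
import Algebra.Properties.CommutativeSemigroup as CommutativeSemigroupProperties
import Algebra.Properties.Group as GroupProperties
import Algebra.Properties.Ring as RingProperties
open import Axiom.ExcludedMiddle using (ExcludedMiddle)
open import Data.Empty using (⊥)
open import Data.Nat.Base using (ℕ; zero; suc)
open import Data.Nat.GeneralisedArithmetic using (fold)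
import Data.Nat.Properties as ℕ
open import Data.Product.Base using (Σ-syntax; ∃; ∃-syntax; _×_; _,_; proj₁; proj₂)
open import Data.Unit.Polymorphic.Base using (⊤; tt)
open import Relation.Binary.Definitions using (_Respects_)
open import Relation.Binary.PropositionalEquality using (subst)
import Relation.Binary.Reasoning.Setoid as SetoidReasoning
open import Relation.Nullary.Decidable.Core using (yes; no; decidable-stable)
open import Relation.Nullary.Negation.Core using (¬_; contradiction)
open import Relation.Unary using (Pred; _∈_; _∉_; _⊆_; _≐_; _∩_; _⊢_)

-- Subgroups and cancellation of their elements.

record IsSubgroup {u : Level} (G : RawGroup u u) (H : Pred (RawGroup.Carrier G) u) : Set u where
  open RawGroup G
  field
    resp-≈    : H Respects _≈_
    ε∈        : ε ∈ H
    ∙-closed  : ∀ {x y} → x ∈ H → y ∈ H → x ∙ y ∈ H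
    ⁻¹-closed : ∀ {x} → x ∈ H → x ⁻¹ ∈ H

module SubgroupProperties {u : Level} (G : Group u u) {H : Pred (Group.Carrier G) u}
                          (H-subgroup : IsSubgroup (Group.rawGroup G) H) where
  open Group G
  open GroupProperties G
  open IsSubgroup H-subgroup

  //-closed : ∀ {x y} → x ∈ H → y ∈ H → x // y ∈ H
  //-closed x∈H y∈H = ∙-closed x∈H (⁻¹-closed y∈H)

  ∈-//-cancelʳ : ∀ {x y} → x // y ∈ H → y ∈ H → x ∈ H
  ∈-//-cancelʳ {x} {y} x/y∈H y∈H = resp-≈ (//-rightDividesˡ y x) (∙-closed x/y∈H y∈H)

  ∈-//-cancelˡ : ∀ {x y} → x ∈ H → x // y ∈ H → y ∈ H
  ∈-//-cancelˡ {x} {y} x∈H x/y∈H =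
    ∈-//-cancelʳ (resp-≈ (⁻¹-anti-homo-// x y) (⁻¹-closed x/y∈H)) x∈H

∩-isSubgroup : {u : Level} {G : RawGroup u u} {H K : Pred (RawGroup.Carrier G) u} →
               IsSubgroup G H → IsSubgroup G K → IsSubgroup G (H ∩ K)
∩-isSubgroup H-sub K-sub = record
  { resp-≈    = λ x≈y (x∈H , x∈K) → H.resp-≈ x≈y x∈H , K.resp-≈ x≈y x∈K
  ; ε∈        = H.ε∈ , K.ε∈
  ; ∙-closed  = λ (x∈H , x∈K) (y∈H , y∈K) → H.∙-closed x∈H y∈H , K.∙-closed x∈K y∈K
  ; ⁻¹-closed = λ (x∈H , x∈K) → H.⁻¹-closed x∈H , K.⁻¹-closed x∈K
  }
  where
  module H = IsSubgroup H-sub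
  module K = IsSubgroup K-sub

submodule⇒subgroup : {u : Level} {R : CommutativeRing u u} (M : Module R u u)
                     {N : Pred (Module.Carrierᴹ M) u} →
                     IsSubmodule M N → IsSubgroup (Module.+ᴹ-rawGroup M) N
submodule⇒subgroup {R = R} M N-sub = record
  { resp-≈    = resp-≈
  ; ε∈        = 0∈
  ; ∙-closed  = +-closed
  ; ⁻¹-closed = λ {x} x∈N → resp-≈ (-1*x≈-x x) (*ₗ-closed (- 1#) x∈N)
  }
  where
  open IsSubmodule N-sub
  open Module M
  open CommutativeRing R using (_+_; -_; 1#; 0#; -‿inverseˡ)
  open GroupProperties +ᴹ-group using (inverseˡ-unique)
  open SetoidReasoning ≈ᴹ-setoid

  -1*x≈-x : ∀ x → (- 1#) *ₗ x ≈ᴹ -ᴹ x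
  -1*x≈-x x = inverseˡ-unique _ _ (begin
    (- 1#) *ₗ x +ᴹ x             ≈⟨ +ᴹ-congˡ (*ₗ-identityˡ x) ⟨
    (- 1#) *ₗ x +ᴹ 1# *ₗ x       ≈⟨ *ₗ-distribʳ x (- 1#) 1# ⟨
    (- 1# + 1#) *ₗ x             ≈⟨ *ₗ-congʳ (-‿inverseˡ 1#) ⟩
    0# *ₗ x                      ≈⟨ *ₗ-zeroˡ x ⟩
    0ᴹ                           ∎)

-- Ideals: principal ideals, annihilators, sums and products.

module Ideals {u : Level} (A : CommutativeRing u u) where
  open CommutativeRing A
  open RingProperties ring
  open Group +-group using () renaming (rawGroup to +-rawGroup)

  module Ideal {I : Pred Carrier u} (I-ideal : IsIdeal A I) where
    open IsSubmodule I-ideal public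

    isSubgroup : IsSubgroup +-rawGroup I
    isSubgroup = submodule⇒subgroup (⟨module⟩ {R = A}) I-ideal

    open SubgroupProperties +-group isSubgroup public
    module Mod = CommutativeRing (Quotient.quotientRing A I I-ideal)

    ≈⇒∼ : ∀ {x y} → x ≈ y → x Mod.≈ y
    ≈⇒∼ = IsRingHomomorphism.⟦⟧-cong (Quotient.π-isHom A I I-ideal)

  line : Carrier → Pred Carrier u
  line b x = ∃[ a ] x ≈ a * b

  line-isIdeal : ∀ b → IsIdeal A (line b)
  line-isIdeal b = record
    { resp-≈    = λ x≈y (a , x≈ab) → a , trans (sym x≈y) x≈ab
    ; 0∈        = 0# , sym (zeroˡ b)
    ; +-closed  = λ (a , x≈ab) (a′ , y≈a′b) →
        a + a′ , trans (+-cong x≈ab y≈a′b) (sym (distribʳ b a a′))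
    ; *ₗ-closed = λ r (a , x≈ab) → r * a , trans (*-congˡ x≈ab) (sym (*-assoc r a b))
    }

  annihilator : Carrier → Pred Carrier u
  annihilator x a = a * x ≈ 0#

  annihilator-isIdeal : ∀ x → IsIdeal A (annihilator x)
  annihilator-isIdeal x = record
    { resp-≈    = λ a≈b ax≈0 → trans (*-congʳ (sym a≈b)) ax≈0
    ; 0∈        = zeroˡ x
    ; +-closed  = λ {a} {b} ax≈0 bx≈0 →
        trans (distribʳ x a b) (trans (+-cong ax≈0 bx≈0) (+-identityˡ 0#))
    ; *ₗ-closed = λ r {a} ax≈0 → trans (*-assoc r a x) (trans (*-congˡ ax≈0) (zeroʳ r))
    }

  infixr 6 _⊕_
  -- The ordinary sum `U + J`, not a direct sum: `x` is congruent modulo `J` to an element of `U`.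
  -- In this form the closure laws come from the operations of the quotient by `J`.
  _⊕_ : Pred Carrier u → Pred Carrier u → Pred Carrier u
  (U ⊕ J) x = ∃[ v ] v ∈ U × (x - v) ∈ J

  module _ {U J : Pred Carrier u} (J-ideal : IsIdeal A J) where
    open Ideal J-ideal

    ⊕-isSubgroup : IsSubgroup +-rawGroup U → IsSubgroup +-rawGroup (U ⊕ J)
    ⊕-isSubgroup U-sub = record
      { resp-≈    = λ x≈y (v , v∈U , x-v∈J) → v , v∈U , resp-≈ (+-congʳ x≈y) x-v∈J
      ; ε∈        = 0# , U.ε∈ , Mod.refl
      ; ∙-closed  = λ (v , v∈U , x∼v) (w , w∈U , y∼w) → v + w , U.∙-closed v∈U w∈U , Mod.+-cong x∼v y∼w
      ; ⁻¹-closed = λ (v , v∈U , x∼v) → - v , U.⁻¹-closed v∈U , Mod.-‿cong x∼v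
      }
      where module U = IsSubgroup U-sub

    ⊕-isIdeal : IsIdeal A U → IsIdeal A (U ⊕ J)
    ⊕-isIdeal U-ideal = record
      { resp-≈    = S.resp-≈
      ; 0∈        = S.ε∈
      ; +-closed  = S.∙-closed
      ; *ₗ-closed = λ r {x} (v , v∈U , x∼v) →
          r * v , U.*ₗ-closed r v∈U , Mod.*-cong {r} {r} {x} {v} (Mod.refl {r}) x∼v
      }
      where
      module U = IsSubmodule U-ideal
      module S = IsSubgroup (⊕-isSubgroup (submodule⇒subgroup (⟨module⟩ {R = A}) U-ideal))

    ⊆-⊕ʳ : 0# ∈ U → J ⊆ U ⊕ J
    ⊆-⊕ʳ 0∈U {x} x∈J = 0# , 0∈U , //-closed x∈J 0∈

    ⊆-⊕ˡ : U ⊆ U ⊕ J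
    ⊆-⊕ˡ {x} x∈U = x , x∈U , Mod.refl

  -- Finite sums of products, generated inductively so that `·-least` is a plain induction. Closure
  -- under scalars is derived when `P` is an ideal.
  data _·_ (P Q : Pred Carrier u) : Pred Carrier u where
    product : ∀ {p q} → p ∈ P → q ∈ Q → (P · Q) (p * q)
    resp    : (P · Q) Respects _≈_
    0∈·     : (P · Q) 0#
    sum     : ∀ {x y} → (P · Q) x → (P · Q) y → (P · Q) (x + y)

  module _ {P Q : Pred Carrier u} where

    ·-isIdeal : IsIdeal A P → IsIdeal A (P · Q)
    ·-isIdeal P-ideal = record
      { resp-≈ = resp ; 0∈ = 0∈· ; +-closed = sum ; *ₗ-closed = λ r → scale r }
      where
      scale : ∀ r {x} → (P · Q) x → (P · Q) (r * x)
      scale r (product p∈P q∈Q) = resp (*-assoc r _ _) (product (IsSubmodule.*ₗ-closed P-ideal r p∈P) q∈Q)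
      scale r (resp x≈y x∈)     = resp (*-congˡ x≈y) (scale r x∈)
      scale r 0∈·               = resp (sym (zeroʳ r)) 0∈·
      scale r (sum x∈ y∈)       = resp (sym (distribˡ r _ _)) (sum (scale r x∈) (scale r y∈))

    ·-least : {J : Pred Carrier u} → IsIdeal A J →
              (∀ {p q} → p ∈ P → q ∈ Q → p * q ∈ J) → (P · Q) ⊆ J
    ·-least J-ideal P*Q⊆J (product p∈P q∈Q) = P*Q⊆J p∈P q∈Q
    ·-least J-ideal P*Q⊆J (resp x≈y x∈)     = IsSubmodule.resp-≈ J-ideal x≈y (·-least J-ideal P*Q⊆J x∈)
    ·-least J-ideal P*Q⊆J 0∈·               = IsSubmodule.0∈ J-ideal
    ·-least J-ideal P*Q⊆J (sum x∈ y∈)       =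
      IsSubmodule.+-closed J-ideal (·-least J-ideal P*Q⊆J x∈) (·-least J-ideal P*Q⊆J y∈)

-- Artinian local rings: minimal ideals, units, Nakayama, one-dimensional quotients.

module ArtinianLocal {u : Level} (em : ∀ ℓ → ExcludedMiddle ℓ) (A : CommutativeRing u u)
                     (artinian : IsArtinian A) (local : IsLocal A) where
  open import Data.Nat.Base using (_+_)
  open CommutativeRing A hiding (_+_; zero)
  open RingProperties ring
  open Ideals A
  open IsLocal local
  private module 𝔪 = Ideal 𝔪-isIdeal
  open SetoidReasoning setoid

  dne : ∀ {ℓ} {P : Set ℓ} → ¬ ¬ P → P
  dne {ℓ} = decidable-stable (em ℓ)

  -- If every candidate contained a strictly smaller one, iterating the choice from `I` would give a
  -- descending chain that never stabilises.
  minimalIdeal : ∀ {ℓ} (Q : Pred (Pred Carrier u) ℓ) {I} → IsIdeal A I → Q I →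
                 ∃[ J ] IsIdeal A J × Q J × (∀ J′ → IsIdeal A J′ → Q J′ → J′ ⊆ J → J ⊆ J′)
  minimalIdeal {ℓ} Q {I₀} I₀-ideal QI₀ = dne λ ¬minimal →
    let
      Candidate = ∃[ J ] IsIdeal A J × Q J

      smaller : (s : Candidate) → Σ[ t ∈ Candidate ] proj₁ t ⊆ proj₁ s × ¬ (proj₁ s ⊆ proj₁ t)
      smaller (J , J-ideal , QJ) = dne λ ¬smaller →
        ¬minimal (J , J-ideal , QJ , λ J′ J′-ideal QJ′ J′⊆J {x} x∈J → dne λ x∉J′ →
          ¬smaller ((J′ , J′-ideal , QJ′) , J′⊆J , λ J⊆J′ → x∉J′ (J⊆J′ x∈J)))

      chain : ℕ → Candidate
      chain = fold (I₀ , I₀-ideal , QI₀) (λ s → proj₁ (smaller s))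

      (n , stable) = artinian (λ n → proj₁ (chain n)) (λ n → proj₁ (proj₂ (chain n)))
                              (λ n → proj₁ (proj₂ (smaller (chain n))))
    in proj₂ (proj₂ (smaller (chain n))) (proj₁ (stable (suc n) (ℕ.n≤1+n n)))

  -- Take `x ≠ 0` in a minimal nonzero ideal inside `line z`. If `jx ≠ 0`, minimality gives
  -- `x = ajx`, so `1 - aj` kills `x`. Hence no proper ideal strictly contains `annihilator x`, and
  -- the uniqueness of the maximal ideal applies.
  simpleSubideal : ∀ {z} → ¬ (z ≈ 0#) → ∃[ x ] x ∈ line z × ¬ (x ≈ 0#) × annihilator x ≐ 𝔪
  simpleSubideal {z} z≉0 =
    let
      Q : Pred (Pred Carrier u) u
      Q J = (∃[ y ] y ∈ J × ¬ (y ≈ 0#)) × (∀ {y} → y ∈ J → y ∈ line z)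

      (I , I-ideal , ((x , x∈I , x≉0) , I⊆Az) , I-minimal) =
        minimalIdeal Q (line-isIdeal z) ((z , (1# , sym (*-identityˡ z)) , z≉0) , λ y∈ → y∈)

      line⊆I : ∀ j → line (j * x) ⊆ I
      line⊆I j (a , y≈ajx) = IsSubmodule.resp-≈ I-ideal (sym y≈ajx)
        (IsSubmodule.*ₗ-closed I-ideal a (IsSubmodule.*ₗ-closed I-ideal j x∈I))

      maximal : ∀ J → IsProperIdeal A J → annihilator x ⊆ J → J ⊆ annihilator x
      maximal J (J-ideal , 1∉J) Ann⊆J {j} j∈J = dne λ jx≉0 →
        let (a , x≈ajx) = I-minimal (line (j * x)) (line-isIdeal (j * x))
              ((j * x , (1# , sym (*-identityˡ (j * x))) , jx≉0) , λ y∈ → I⊆Az (line⊆I j y∈))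
              (line⊆I j) x∈I
            1-aj∈Ann : (1# - a * j) * x ≈ 0#
            1-aj∈Ann = begin
              (1# - a * j) * x          ≈⟨ [y-z]x≈yx-zx x 1# (a * j) ⟩
              1# * x - a * j * x        ≈⟨ +-cong (*-identityˡ x) (-‿cong (trans (*-assoc a j x) (sym x≈ajx))) ⟩
              x - x                     ≈⟨ -‿inverseʳ x ⟩
              0#                        ∎
        in 1∉J (Ideal.∈-//-cancelʳ J-ideal (Ann⊆J 1-aj∈Ann) (IsSubmodule.*ₗ-closed J-ideal a j∈J))
    in x , I⊆Az x∈I , x≉0
       , 𝔪-unique (annihilator x)
           ((annihilator-isIdeal x , λ 1x≈0 → x≉0 (trans (sym (*-identityˡ x)) 1x≈0)) , maximal)

  -- A multiple x of z with annihilator 𝔪 would be killed by a.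
  ∉𝔪⇒nonZeroDivisor : ∀ {a z} → a ∉ 𝔪 → a * z ≈ 0# → z ≈ 0#
  ∉𝔪⇒nonZeroDivisor {a} {z} a∉𝔪 az≈0 = dne λ z≉0 →
    let (x , (r , x≈rz) , _ , Ann≐𝔪) = simpleSubideal z≉0
    in a∉𝔪 (proj₁ Ann≐𝔪 (begin
         a * x         ≈⟨ *-congˡ x≈rz ⟩
         a * (r * z)   ≈⟨ *-congˡ (*-comm r z) ⟩
         a * (z * r)   ≈⟨ *-assoc a z r ⟨
         a * z * r     ≈⟨ *-congʳ az≈0 ⟩
         0# * r        ≈⟨ zeroˡ r ⟩
         0#            ∎))

  -- The ideals generated by the powers of `a` stabilise, so `a^n = c a^(n+1)`, that is
  -- `a^n (1 - ca) = 0`. Since `a` is no zero divisor, the `n` factors cancel.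
  ∉𝔪⇒invertible : ∀ {a} → a ∉ 𝔪 → ∃[ c ] c * a ≈ 1#
  ∉𝔪⇒invertible {a} a∉𝔪 =
    let (n , stable) = artinian (λ n → line (pow n)) (λ n → line-isIdeal (pow n)) descending
        (c , aⁿ≈caⁿ⁺¹) = proj₁ (stable (suc n) (ℕ.n≤1+n n)) (1# , sym (*-identityˡ (pow n)))
    in c , sym (x∙y⁻¹≈ε⇒x≈y 1# (c * a) (cancel n (begin
         pow n * (1# - c * a)               ≈⟨ x[y-z]≈xy-xz (pow n) 1# (c * a) ⟩
         pow n * 1# - pow n * (c * a)       ≈⟨ +-cong (*-identityʳ (pow n)) (-‿cong (*-comm (pow n) (c * a))) ⟩
         pow n - c * a * pow n              ≈⟨ +-congˡ (-‿cong (trans (*-assoc c a (pow n)) (sym aⁿ≈caⁿ⁺¹))) ⟩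
         pow n - pow n                      ≈⟨ -‿inverseʳ (pow n) ⟩
         0#                                 ∎)))
    where
    pow : ℕ → Carrier
    pow zero    = 1#
    pow (suc n) = a * pow n

    descending : ∀ n → line (pow (suc n)) ⊆ line (pow n)
    descending n (r , x≈) = r * a , trans x≈ (sym (*-assoc r a (pow n)))

    cancel : ∀ n {z} → pow n * z ≈ 0# → z ≈ 0#
    cancel zero    {z} 1z≈0 = trans (sym (*-identityˡ z)) 1z≈0
    cancel (suc n) {z} az≈0 = cancel n (∉𝔪⇒nonZeroDivisor a∉𝔪 (trans (sym (*-assoc a (pow n) z)) az≈0))

  ∉𝔪-cancelˡ : ∀ {J} → IsIdeal A J → ∀ {a b} → a ∉ 𝔪 → a * b ∈ J → b ∈ J
  ∉𝔪-cancelˡ J-ideal {a} {b} a∉𝔪 ab∈J =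
    let (c , ca≈1) = ∉𝔪⇒invertible a∉𝔪
    in IsSubmodule.resp-≈ J-ideal
         (trans (sym (*-assoc c a b)) (trans (*-congʳ ca≈1) (*-identityˡ b)))
         (IsSubmodule.*ₗ-closed J-ideal c ab∈J)

  fixedBy𝔪⇒0 : ∀ {m x} → m ∈ 𝔪 → x ≈ m * x → x ≈ 0#
  fixedBy𝔪⇒0 {m} {x} m∈𝔪 x≈mx = ∉𝔪⇒nonZeroDivisor
    (λ 1-m∈𝔪 → proj₂ (proj₁ 𝔪-isMaximal) (𝔪.∈-//-cancelʳ 1-m∈𝔪 m∈𝔪)) (begin
      (1# - m) * x      ≈⟨ [y-z]x≈yx-zx x 1# m ⟩
      1# * x - m * x    ≈⟨ +-cong (*-identityˡ x) (-‿cong (sym x≈mx)) ⟩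
      x - x             ≈⟨ -‿inverseʳ x ⟩
      0#                ∎)

  -- Nakayama's lemma without finite generation: if I ⊆ 𝔪I, a minimal J with
  -- JI ≠ 0 is generated by some x, and 𝔪x ⊆ J also has (𝔪x)I ≠ 0.
  nakayama : ∀ {I} → IsIdeal A I → ∀ {z} → z ∈ I → ¬ (z ≈ 0#) → ¬ (I ⊆ (𝔪 · I))
  nakayama {I} I-ideal {z} z∈I z≉0 I⊆𝔪I =
    let
      -- `Q J` says `JI ≠ 0`; the unit ideal satisfies it through `1` and `z`.
      Q : Pred (Pred Carrier u) u
      Q J = ∃[ x ] ∃[ y ] x ∈ J × y ∈ I × ¬ (y * x ≈ 0#)

      (J , J-ideal , (x , y , x∈J , y∈I , yx≉0) , J-minimal) =
        minimalIdeal Q (line-isIdeal 1#)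
          (1# , z , (1# , sym (*-identityˡ 1#)) , z∈I , λ z1≈0 → z≉0 (trans (sym (*-identityʳ z)) z1≈0))

      (m , i , m∈𝔪 , i∈I , imx≉0) = nonzeroProduct yx≉0 (I⊆𝔪I y∈I)

      -- The ideal generated by `mx` lies in `J` and is not killed by `i`, so by minimality it
      -- contains `x`.
      (a , x≈amx) = J-minimal (line (m * x)) (line-isIdeal (m * x))
        (m * x , i , (1# , sym (*-identityˡ (m * x))) , i∈I , imx≉0)
        (λ (a , w≈amx) → IsSubmodule.resp-≈ J-ideal (sym w≈amx)
          (IsSubmodule.*ₗ-closed J-ideal a (IsSubmodule.*ₗ-closed J-ideal m x∈J)))
        x∈J

      x≈0 = fixedBy𝔪⇒0 (𝔪.*ₗ-closed a m∈𝔪) (trans x≈amx (sym (*-assoc a m x)))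
    in yx≉0 (trans (*-congˡ x≈0) (zeroʳ y))
    where
    -- If every generator of `𝔪 · I` killed `x`, so would `y`, since the annihilator of `x` is an
    -- ideal.
    nonzeroProduct : ∀ {x y} → ¬ (y * x ≈ 0#) → y ∈ (𝔪 · I) →
                     ∃[ m ] ∃[ i ] m ∈ 𝔪 × i ∈ I × ¬ (i * (m * x) ≈ 0#)
    nonzeroProduct {x} yx≉0 y∈𝔪I = dne λ none →
      yx≉0 (·-least (annihilator-isIdeal x)
        (λ {m} {i} m∈𝔪 i∈I → dne λ mix≉0 → none (m , i , m∈𝔪 , i∈I , λ imx≈0 →
          mix≉0 (trans (*-congʳ (*-comm m i)) (trans (*-assoc i m x) imx≈0)))) y∈𝔪I)

  -- Says that `I/I′` is one-dimensional over the residue field: the class of `b` is nonzero, is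
  -- killed by `𝔪` and spans.
  record SimpleStep (I : Pred Carrier u) : Set (Level.suc u) where
    field
      I′       : Pred Carrier u
      I′-ideal : IsIdeal A I′
      I′⊆I     : I′ ⊆ I
      b        : Carrier
      b∈I      : b ∈ I
      b∉I′     : b ∉ I′
      𝔪b⊆I′    : ∀ {m} → m ∈ 𝔪 → m * b ∈ I′
      spans    : I ⊆ line b ⊕ I′

  -- I/𝔪I is a nonzero vector space with the descending chain condition on
  -- subspaces.  If it had no subspace of codimension one, one could pick an
  -- infinite linearly independent sequence b, and the spans of its tails would
  -- form a strictly descending chain.
  simpleStep : ∀ {I} → IsIdeal A I → ∀ {z} → z ∈ I → ¬ (z ≈ 0#) → SimpleStep I
  simpleStep {I} I-ideal {z} z∈I z≉0 = dne λ ¬step → Infinite.absurd ¬step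
    where
    module I = IsSubmodule I-ideal

    module Infinite (¬step : ¬ SimpleStep I) where
      choose : Pred Carrier u → Carrier
      choose J with em u {∃[ b ] b ∈ I × b ∉ J}
      ... | yes (b , _) = b
      -- A placeholder value: `choose-spec` is applied only to `J` that do not contain `I`, which
      -- rules this case out.
      ... | no _        = 0#

      choose-spec : ∀ J → ¬ (I ⊆ J) → choose J ∈ I × choose J ∉ J
      choose-spec J I⊈J with em u {∃[ b ] b ∈ I × b ∉ J}
      ... | yes (_ , spec) = spec
      ... | no ¬b          = contradiction (λ {x} x∈I → dne λ x∉J → ¬b (x , x∈I , x∉J)) I⊈J

      -- `stage n` is `𝔪 · I` plus the span of the first `n` terms of the sequence; the next term is
      -- chosen in `I` outside it.
      stage : ℕ → Pred Carrier u
      b : ℕ → Carrier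
      stage zero    = 𝔪 · I
      stage (suc n) = line (b n) ⊕ stage n
      b n = choose (stage n)

      -- `𝔪 · I` plus the span of the `d` terms from `b n` on. The index is `d + n`, not `n + d`, so
      -- that `stage (suc d + n)` unfolds in step with it.
      segment : ℕ → ℕ → Pred Carrier u
      segment n zero    = 𝔪 · I
      segment n (suc d) = line (b (d + n)) ⊕ segment n d

      stage-isIdeal : ∀ n → IsIdeal A (stage n)
      stage-isIdeal zero    = ·-isIdeal 𝔪-isIdeal
      stage-isIdeal (suc n) = ⊕-isIdeal (stage-isIdeal n) (line-isIdeal (b n))

      segment-isIdeal : ∀ n d → IsIdeal A (segment n d)
      segment-isIdeal n zero    = ·-isIdeal 𝔪-isIdeal
      segment-isIdeal n (suc d) = ⊕-isIdeal (segment-isIdeal n d) (line-isIdeal (b (d + n)))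

      0∈line : ∀ x → 0# ∈ line x
      0∈line x = IsSubmodule.0∈ (line-isIdeal x)

      self∈line : ∀ x → x ∈ line x
      self∈line x = 1# , sym (*-identityˡ x)

      𝔪I⊆stage : ∀ n → (𝔪 · I) ⊆ stage n
      𝔪I⊆stage zero    x∈ = x∈
      𝔪I⊆stage (suc n) x∈ = ⊆-⊕ʳ (stage-isIdeal n) (0∈line (b n)) (𝔪I⊆stage n x∈)

      𝔪I⊆segment : ∀ n d → (𝔪 · I) ⊆ segment n d
      𝔪I⊆segment n zero    x∈ = x∈
      𝔪I⊆segment n (suc d) x∈ = ⊆-⊕ʳ (segment-isIdeal n d) (0∈line (b (d + n))) (𝔪I⊆segment n d x∈)

      -- The start is Nakayama. If `stage (suc n)` contained `I`, then `stage n` would have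
      -- codimension one in `I`, giving a `SimpleStep`, which is excluded.
      stage-proper : ∀ n → stage n ⊆ I × ¬ (I ⊆ stage n)
      stage-proper zero    = ·-least I-ideal (λ {m} _ → I.*ₗ-closed m) , nakayama I-ideal z∈I z≉0
      stage-proper (suc n) =
        let (stage⊆I , I⊈stage) = stage-proper n
            (b∈I , b∉stage) = choose-spec (stage n) I⊈stage
        in (λ (v , (a , v≈ab) , x-v∈) →
              Ideal.∈-//-cancelʳ I-ideal (stage⊆I x-v∈) (I.resp-≈ (sym v≈ab) (I.*ₗ-closed a b∈I)))
         , (λ I⊆next → ¬step (record
             { I′ = stage n ; I′-ideal = stage-isIdeal n ; I′⊆I = stage⊆I
             ; b = b n ; b∈I = b∈I ; b∉I′ = b∉stage
             ; 𝔪b⊆I′ = λ m∈𝔪 → 𝔪I⊆stage n (product m∈𝔪 b∈I)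
             ; spans = I⊆next }))

      b-spec : ∀ n → b n ∈ I × b n ∉ stage n
      b-spec n = choose-spec (stage n) (proj₂ (stage-proper n))

      segment⊆stage : ∀ n d → segment n d ⊆ stage (d + n)
      segment⊆stage n zero    x∈            = 𝔪I⊆stage n x∈
      segment⊆stage n (suc d) (v , v∈ , x-v∈) = v , v∈ , segment⊆stage n d x-v∈

      stage-ascending : ∀ n d → stage n ⊆ stage (d + n)
      stage-ascending n zero    x∈ = x∈
      stage-ascending n (suc d) x∈ =
        ⊆-⊕ʳ (stage-isIdeal (d + n)) (0∈line (b (d + n))) (stage-ascending n d x∈)

      segment-ascending : ∀ n d e → segment n d ⊆ segment n (e + d)
      segment-ascending n d zero    x∈ = x∈
      segment-ascending n d (suc e) x∈ =
        ⊆-⊕ʳ (segment-isIdeal n (e + d)) (0∈line (b (e + d + n))) (segment-ascending n d e x∈)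

      -- Adds `b n` at the front of the run, although segments grow at the back; this makes the
      -- tails a descending chain.
      segment-extend : ∀ n d → segment (suc n) d ⊆ segment n (suc d)
      segment-extend n zero    x∈              = ⊆-⊕ʳ (segment-isIdeal n 0) (0∈line (b n)) x∈
      segment-extend n (suc d) (v , v∈ , x-v∈) =
        v , subst (λ k → v ∈ line (b k)) (ℕ.+-suc d n) v∈ , segment-extend n d x-v∈

      tail : ℕ → Pred Carrier u
      tail n x = ∃[ d ] x ∈ segment n d

      tail-isIdeal : ∀ n → IsIdeal A (tail n)
      tail-isIdeal n = record
        { resp-≈    = λ x≈y (d , x∈) → d , IsSubmodule.resp-≈ (segment-isIdeal n d) x≈y x∈
        ; 0∈        = 0 , 0∈·
        ; +-closed  = λ {x} {y} (d , x∈) (e , y∈) → e + d ,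
            IsSubmodule.+-closed (segment-isIdeal n (e + d)) (segment-ascending n d e x∈)
              (subst (λ k → y ∈ segment n k) (ℕ.+-comm d e) (segment-ascending n e d y∈))
        ; *ₗ-closed = λ r (d , x∈) → d , IsSubmodule.*ₗ-closed (segment-isIdeal n d) r x∈
        }

      -- Linear independence modulo `𝔪 · I`. If the last coefficient `a` lies in `𝔪`, its term is
      -- absorbed by `𝔪 · I`; otherwise `a` is a unit and the last term of the run would lie in the
      -- stage it was chosen to avoid.
      b∉segment : ∀ n d → b n ∉ segment (suc n) d
      b∉segment n zero    b∈ = proj₂ (b-spec n) (𝔪I⊆stage n b∈)
      b∉segment n (suc d) (v , (a , v≈ab) , b-v∈) with em u {a ∈ 𝔪}
      ... | yes a∈𝔪 = b∉segment n d (Ideal.∈-//-cancelʳ (segment-isIdeal (suc n) d) b-v∈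
              (𝔪I⊆segment (suc n) d (resp (sym v≈ab) (product a∈𝔪 (proj₁ (b-spec (d + suc n)))))))
      ... | no a∉𝔪  = proj₂ (b-spec (d + suc n)) (∉𝔪-cancelˡ (stage-isIdeal (d + suc n)) a∉𝔪
              (IsSubmodule.resp-≈ (stage-isIdeal (d + suc n)) v≈ab
                (Ideal.∈-//-cancelˡ (stage-isIdeal (d + suc n))
                  (stage-ascending (suc n) d (⊆-⊕ˡ (stage-isIdeal n) (self∈line (b n))))
                  (segment⊆stage (suc n) d b-v∈))))

      absurd : ⊥
      absurd =
        let (n , stable) = artinian tail tail-isIdeal (λ n (d , x∈) → suc d , segment-extend n d x∈)
            (d , b∈) = proj₁ (stable (suc n) (ℕ.n≤1+n n)) (1 , ⊆-⊕ˡ (segment-isIdeal n 0) (self∈line (b n)))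
        in b∉segment n d b∈

-- Linear maps, linear topologies and pulled-back ST module structures.

record IsLinear {u : Level} {R : CommutativeRing u u} (M N : Module R u u)
                (f : Module.Carrierᴹ M → Module.Carrierᴹ N) : Set u where
  private
    module M = Module M
    module N = Module N
  field
    cong   : ∀ {x y} → x M.≈ᴹ y → f x N.≈ᴹ f y
    +-homo : ∀ x y → f (x M.+ᴹ y) N.≈ᴹ f x N.+ᴹ f y
    *-homo : ∀ r x → f (r M.*ₗ x) N.≈ᴹ r N.*ₗ f x

  0-homo : f M.0ᴹ N.≈ᴹ N.0ᴹ
  0-homo = N.≈ᴹ-trans (cong (M.≈ᴹ-sym (M.*ₗ-zeroˡ M.0ᴹ)))
             (N.≈ᴹ-trans (*-homo _ M.0ᴹ) (N.*ₗ-zeroˡ _))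

module LinearTopologyProperties {u : Level} {𝕜 : CommutativeRing u u} (M : Module 𝕜 u u)
                                {τ : Topology (Module.≈ᴹ-setoid M)}
                                (linear : IsLinearTopology M τ) where
  open Module M
  open Topology τ using (open-resp-≈; open-resp-≐; open-⋃)
  open IsLinearTopology linear
  open GroupProperties +ᴹ-group

  -- `U` is the union of the chosen neighbourhoods, indexed by its own points.
  open-local : ∀ {U} → (∀ {x} → x ∈ U → ∃[ V ] IsOpen τ V × x ∈ V × V ⊆ U) → IsOpen τ U
  open-local {U} nbhd = open-resp-≐
    ((λ ((x , x∈U) , y∈V) → proj₂ (proj₂ (proj₂ (nbhd x∈U))) y∈V) ,
     (λ {x} x∈U → (x , x∈U) , proj₁ (proj₂ (proj₂ (nbhd x∈U)))))
    (open-⋃ (∃ U) (λ (_ , x∈U) → proj₁ (nbhd x∈U)) (λ (_ , x∈U) → proj₁ (proj₂ (nbhd x∈U))))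

  translate-open : ∀ x {U} → IsOpen τ U → IsOpen τ ((x +ᴹ_) ⊢ U)
  translate-open x oU = open-local λ x+y∈U →
    let (V , W , _ , oW , (x∈V , y∈W) , V×W⊆U) = +-continuous oU x+y∈U
    in W , oW , y∈W , λ z∈W → V×W⊆U (x∈V , z∈W)

  -- Each `x` in `H` has the open neighbourhood `x + O`, which stays inside `H`.
  subgroup-open : ∀ {H O} → IsSubgroup +ᴹ-rawGroup H → IsOpen τ O → 0ᴹ ∈ O → O ⊆ H → IsOpen τ H
  subgroup-open H-sub oO 0∈O O⊆H = open-local λ {x} x∈H →
    _ , translate-open (-ᴹ x) oO , open-resp-≈ oO (≈ᴹ-sym (-ᴹ‿inverseˡ x)) 0∈O
      , λ {y} -x+y∈O → H.resp-≈ (\\-leftDividesˡ x y) (H.∙-closed x∈H (O⊆H -x+y∈O))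
    where module H = IsSubgroup H-sub

  cosetBasis : ∀ {U x} → IsOpen τ U → x ∈ U →
               ∃[ N ] IsSubmodule M N × IsOpen τ N × ((-ᴹ x +ᴹ_) ⊢ N) ⊆ U
  cosetBasis {x = x} oU x∈U =
    let (N , N-sub , oN , N⊆U-x) =
          submodule-basis (translate-open x oU) (open-resp-≈ oU (≈ᴹ-sym (+ᴹ-identityʳ x)) x∈U)
    in N , N-sub , oN , λ {y} -x+y∈N → open-resp-≈ oU (\\-leftDividesˡ x y) (N⊆U-x -x+y∈N)

-- The initial topology along `f`, with preimages taken up to `≐` because openness must depend only
-- on the extension of a predicate.
pullback : {u : Level} {R : CommutativeRing u u} (M N : Module R u u)
           {f : Module.Carrierᴹ M → Module.Carrierᴹ N} → IsLinear M N f →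
           Topology (Module.≈ᴹ-setoid N) → Topology (Module.≈ᴹ-setoid M)
pullback M N {f} f-linear τ = record
  { IsOpen      = λ U → ∃[ V ] IsOpen τ V × U ≐ f ⊢ V
  ; open-resp-≈ = λ (V , oV , U⊆ , ⊆U) x≈y x∈U → ⊆U (open-resp-≈ oV (IsLinear.cong f-linear x≈y) (U⊆ x∈U))
  ; open-resp-≐ = λ (U⊆U′ , U′⊆U) (V , oV , U⊆ , ⊆U) →
      V , oV , (λ x∈U′ → U⊆ (U′⊆U x∈U′)) , (λ x∈V → U⊆U′ (⊆U x∈V))
  ; open-whole  = _ , open-whole , (λ _ → tt) , (λ _ → tt)
  ; open-∩      = λ (V , oV , U⊆ , ⊆U) (V′ , oV′ , U′⊆ , ⊆U′) → V ∩ V′ , open-∩ oV oV′ ,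
      (λ (x∈U , x∈U′) → U⊆ x∈U , U′⊆ x∈U′) , (λ (x∈V , x∈V′) → ⊆U x∈V , ⊆U′ x∈V′)
  ; open-⋃      = λ I F oF → _ , open-⋃ I (λ i → proj₁ (oF i)) (λ i → proj₁ (proj₂ (oF i))) ,
      (λ (i , x∈F) → i , proj₁ (proj₂ (proj₂ (oF i))) x∈F) ,
      (λ (i , x∈V) → i , proj₂ (proj₂ (proj₂ (oF i))) x∈V)
  }
  where open Topology τ using (open-resp-≈; open-whole; open-∩; open-⋃)

module STModules {u : Level} {𝕜 : CommutativeRing u u} (R : STRing 𝕜) where
  open STRing R

  -- Supplies competitors for a fine topology: comparing it with the pullback along a linear map
  -- shows that map to be continuous.
  pullback-isSTModule : (M N : Module ring u u) {f : Module.Carrierᴹ M → Module.Carrierᴹ N}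
                        (f-linear : IsLinear M N f) {τ : Topology (Module.≈ᴹ-setoid N)} →
                        IsSTModule R N τ → IsSTModule R M (pullback M N f-linear τ)
  pullback-isSTModule M N {f} f-linear {τ} st = record
    { isLinearᴹ = record
      { +-continuous    = λ {U} (V , oV , U⊆ , ⊆U) {p} p∈ →
          let (V₁ , V₂ , oV₁ , oV₂ , ∈V₁×V₂ , V₁×V₂⊆) =
                L.+-continuous oV {f (proj₁ p) , f (proj₂ p)} (open-resp-≈ oV (+-homo _ _) (U⊆ p∈))
          in f ⊢ V₁ , f ⊢ V₂ , preimage oV₁ , preimage oV₂ , ∈V₁×V₂ ,
             λ {(x , y)} q → ⊆U (open-resp-≈ oV (N.≈ᴹ-sym (+-homo x y)) (V₁×V₂⊆ {f x , f y} q))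
      ; *ₗ-continuous   = λ {U} (V , oV , U⊆ , ⊆U) {p} p∈ →
          let (V₁ , V₂ , oV₁ , oV₂ , ∈V₁×V₂ , V₁×V₂⊆) =
                L.*ₗ-continuous oV {proj₁ p , f (proj₂ p)} (open-resp-≈ oV (*-homo _ _) (U⊆ p∈))
          in V₁ , f ⊢ V₂ , oV₁ , preimage oV₂ , ∈V₁×V₂ ,
             λ {(c , x)} q → ⊆U (open-resp-≈ oV (N.≈ᴹ-sym (*-homo _ x)) (V₁×V₂⊆ {c , f x} q))
      ; submodule-basis = λ {U} (V , oV , U⊆ , ⊆U) 0∈U →
          let (S , S-sub , oS , S⊆V) = L.submodule-basis oV (open-resp-≈ oV 0-homo (U⊆ 0∈U))
              module S = IsSubmodule S-sub
          in f ⊢ S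
           , record
             { resp-≈    = λ x≈y → S.resp-≈ (cong x≈y)
             ; 0∈        = S.resp-≈ (N.≈ᴹ-sym 0-homo) S.0∈
             ; +-closed  = λ x∈S y∈S → S.resp-≈ (N.≈ᴹ-sym (+-homo _ _)) (S.+-closed x∈S y∈S)
             ; *ₗ-closed = λ c x∈S → S.resp-≈ (N.≈ᴹ-sym (*-homo _ _)) (S.*ₗ-closed c x∈S)
             }
           , preimage oS , λ x∈S → ⊆U (S⊆V x∈S)
      }
    ; *ₗ-continuousʳ = λ a (V , oV , U⊆ , ⊆U) → _ , *ₗ-continuousʳ a oV ,
        (λ ax∈U → open-resp-≈ oV (*-homo a _) (U⊆ ax∈U)) ,
        (λ afx∈V → ⊆U (open-resp-≈ oV (N.≈ᴹ-sym (*-homo a _)) afx∈V))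
    ; *ₗ-continuousˡ = λ m (V , oV , U⊆ , ⊆U) → Topology.open-resp-≐ topology
        ((λ afm∈V → ⊆U (open-resp-≈ oV (N.≈ᴹ-sym (*-homo _ m)) afm∈V)) ,
         (λ am∈U → open-resp-≈ oV (*-homo _ m) (U⊆ am∈U)))
        (*ₗ-continuousˡ (f m) oV)
    }
    where
    open IsLinear f-linear
    open IsSTModule st
    open Topology τ using (open-resp-≈)
    module N = Module N
    module L = IsLinearTopology isLinearᴹ

    preimage : ∀ {V} → IsOpen τ V → IsOpen (pullback M N f-linear τ) (f ⊢ V)
    preimage {V} oV = V , oV , (λ x∈ → x∈) , (λ x∈ → x∈)

  self-isSTModule : IsSTModule R (⟨module⟩ {R = ring}) topology
  self-isSTModule = record
    { isLinearᴹ      = isLinear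
    ; *ₗ-continuousʳ = *-continuous
    ; *ₗ-continuousˡ = λ m oU → Topology.open-resp-≐ topology
        (Topology.open-resp-≈ topology oU (*-comm _ _) , Topology.open-resp-≈ topology oU (*-comm _ _))
        (*-continuous m oU)
    }
    where open CommutativeRing ring using (*-comm)

  -- The half of preciseness that every lifting has: `k ↦ ⟦ k ⟧ * m` is the continuous map `h`
  -- followed by a multiplication of `R`.
  restrict-isSTModule : (S : STRing 𝕜) (h : STHom S R) →
    IsSTModule S (restrict (STRing.ring S) ring (STHom.⟦_⟧ h) (STHom.isHom h) (⟨module⟩ {R = ring})) topology
  restrict-isSTModule S h = record
    { isLinearᴹ = record
      { +-continuous    = +-continuous
      ; *ₗ-continuous   = λ oU {p} p∈ →
          let (V , W , oV , oW , p∈V×W , V×W⊆U) =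
                *ₗ-continuous oU {p} (open-resp-≈ oU (*-congʳ (𝕜-linear (proj₁ p))) p∈)
          in V , W , oV , oW , p∈V×W ,
             λ {(c , x)} q → open-resp-≈ oU (*-congʳ (sym (𝕜-linear c))) (V×W⊆U {c , x} q)
      ; submodule-basis = λ oU 0∈U →
          let (N , N-sub , oN , N⊆U) = submodule-basis oU 0∈U
              module N = IsSubmodule N-sub
          in N , record { resp-≈ = N.resp-≈ ; 0∈ = N.0∈ ; +-closed = N.+-closed
                        ; *ₗ-closed = λ c x∈N → N.resp-≈ (*-congʳ (sym (𝕜-linear c))) (N.*ₗ-closed c x∈N) }
             , oN , N⊆U
      }
    ; *ₗ-continuousʳ = λ k → *-continuous ⟦ k ⟧
    ; *ₗ-continuousˡ = λ m oU → continuous (IsSTModule.*ₗ-continuousˡ self-isSTModule m oU)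
    }
    where
    open STHom h
    open CommutativeRing ring using (*-congʳ; sym)
    open IsLinearTopology isLinear
    open Topology topology using (open-resp-≈)

-- Comparison of an arbitrary lifting `σ` with a precise lifting `σ₀`.

module Comparison {u : Level} (em : ∀ ℓ → ExcludedMiddle ℓ) (𝕜 : CommutativeRing u u) (A : STRing 𝕜)
                  (artinian : IsArtinian (STRing.ring A)) (local : IsLocal (STRing.ring A))
                  (τK : Topology (CommutativeRing.setoid (Residue.K A local)))
                  (fine : Residue.IsFineOnK A local τK)
                  (σ₀ : Liftings.Lifting A local τK fine)
                  (precise : Liftings.IsPrecise A local τK fine σ₀)
                  (σ : Liftings.Lifting A local τK fine) where
  open STRing A using (ring; structureMap; structureMap-isHom; topology; isLinear)
  open CommutativeRing ring hiding (ring; zero)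
  open RingProperties (CommutativeRing.ring ring)
  open Ideals ring
  open ArtinianLocal em ring artinian local
  open IsLocal local
  open Liftings A local τK fine
  open Residue A local using (K)
  open Group +-group using () renaming (rawGroup to +-rawGroup)
  private
    module σ = Lifting σ
    module σ₀ = Lifting σ₀
    module σH = IsRingHomomorphism σ.isHom
    module σ₀H = IsRingHomomorphism σ₀.isHom
    module K = CommutativeRing K

  A₀ Aσ : Module K u u
  A₀ = restrict K ring σ₀.⟦_⟧ σ₀.isHom (⟨module⟩ {R = ring})
  Aσ = restrict K ring σ.⟦_⟧ σ.isHom (⟨module⟩ {R = ring})

  isSTModule : IsSTModule ST-K Aσ topology
  isSTModule = STModules.restrict-isSTModule A ST-K σ.hom

  -- Preciseness of `σ₀` enters here: the pullback of `τK` along `φ` is an ST module topology on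
  -- `A₀`, so the given topology is finer.
  functional-continuous : ∀ {φ} → IsLinear A₀ (⟨module⟩ {R = K}) φ → Continuous topology τK φ
  functional-continuous φ-linear {U} oU =
    proj₂ precise (pullback A₀ (⟨module⟩ {R = K}) φ-linear τK)
      (STModules.pullback-isSTModule ST-K A₀ (⟨module⟩ {R = K}) φ-linear (STModules.self-isSTModule ST-K))
      (U , oU , (λ x∈ → x∈) , (λ x∈ → x∈))

  -- Used to extend functionals on `I/I′` to all of `A`. It is corrected at each descent step, which
  -- avoids choosing complements.
  record Retraction (I : Pred Carrier u) : Set u where
    field
      q        : Carrier → Carrier
      q-linear : IsLinear A₀ A₀ q
      q∈I      : ∀ x → q x ∈ I
      q-fixes  : ∀ {x} → x ∈ I → q x ≈ x

  -- One descent step, from `I` to `I′`.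

  module Descent {I : Pred Carrier u} (I-ideal : IsIdeal ring I) (retraction : Retraction I)
                 (step : SimpleStep I) where
    open Retraction retraction
    open SimpleStep step
    private
      module I′ = Ideal I′-ideal
      module q = IsLinear q-linear
      module A/I′ = I′.Mod
    open I′ using (≈⇒∼)

    -- `𝔪` kills `b` modulo `I′`. Together with `*b-injective` this makes `a ↦ ab` an embedding of
    -- `K` into `A/I′`.
    *b-cong : ∀ {a a′} → a K.≈ a′ → (a * b) A/I′.≈ (a′ * b)
    *b-cong {a} {a′} a∼a′ = I′.resp-≈ ([y-z]x≈yx-zx b a a′) (𝔪b⊆I′ a∼a′)

    *b-injective : ∀ {a a′} → (a * b) A/I′.≈ (a′ * b) → a K.≈ a′
    *b-injective {a} {a′} ab∼a′b = dne λ a≁a′ →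
      b∉I′ (∉𝔪-cancelˡ I′-ideal a≁a′ (I′.resp-≈ (sym ([y-z]x≈yx-zx b a a′)) ab∼a′b))

    coordinate : ∀ x → ∃[ a ] q x A/I′.≈ (a * b)
    coordinate x =
      let (v , (a , v≈ab) , qx∼v) = spans (q∈I x)
      in a , A/I′.trans {q x} {v} {a * b} qx∼v (≈⇒∼ v≈ab)

    -- The coordinate of `q x` along `b`. It is an arbitrary choice in `A` but is determined in `K`,
    -- so its laws are stated there.
    φ : Carrier → Carrier
    φ x = proj₁ (coordinate x)

    φ-spec : ∀ x → q x A/I′.≈ (φ x * b)
    φ-spec x = proj₂ (coordinate x)

    φ-unique : ∀ {x a} → q x A/I′.≈ (a * b) → φ x K.≈ a
    φ-unique {x} {a} qx∼ab = *b-injective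
      (A/I′.trans {φ x * b} {q x} {a * b} (A/I′.sym {q x} {φ x * b} (φ-spec x)) qx∼ab)

    φ-linear : IsLinear A₀ (⟨module⟩ {R = K}) φ
    φ-linear = record
      { cong   = λ {x} {y} x≈y → φ-unique (begin
          q x        ≈⟨ ≈⇒∼ (q.cong x≈y) ⟩
          q y        ≈⟨ φ-spec y ⟩
          φ y * b    ∎)
      ; +-homo = λ x y → φ-unique (begin
          q (x + y)            ≈⟨ ≈⇒∼ (q.+-homo x y) ⟩
          q x + q y            ≈⟨ A/I′.+-cong {q x} {φ x * b} {q y} {φ y * b} (φ-spec x) (φ-spec y) ⟩
          φ x * b + φ y * b    ≈⟨ ≈⇒∼ (distribʳ b (φ x) (φ y)) ⟨
          (φ x + φ y) * b      ∎)
      ; *-homo = λ k x → φ-unique (begin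
          q (σ₀.⟦ k ⟧ * x)        ≈⟨ ≈⇒∼ (q.*-homo k x) ⟩
          σ₀.⟦ k ⟧ * q x          ≈⟨ A/I′.*-congˡ {σ₀.⟦ k ⟧} {q x} {φ x * b} (φ-spec x) ⟩
          σ₀.⟦ k ⟧ * (φ x * b)    ≈⟨ ≈⇒∼ (*-assoc σ₀.⟦ k ⟧ (φ x) b) ⟨
          σ₀.⟦ k ⟧ * φ x * b      ≈⟨ *b-cong (K.*-congʳ {φ x} {σ₀.⟦ k ⟧} {k} (σ₀.section k)) ⟩
          k * φ x * b             ∎)
      }
      where open SetoidReasoning A/I′.setoid

    private module φ = IsLinear φ-linear

    -- Modulo `I′`, multiplication into `b` sees only the class in `K`, so any lifting may be
    -- inserted; here `σ` and `σ₀` become interchangeable.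
    q∼lifted-φ : (τ : Lifting) → ∀ x → q x A/I′.≈ (Lifting.⟦_⟧ τ (φ x) * b)
    q∼lifted-φ τ x = A/I′.trans {q x} {φ x * b} (φ-spec x)
      (*b-cong (K.sym {Lifting.⟦_⟧ τ (φ x)} {φ x} (Lifting.section τ (φ x))))

    -- Subtracts from `q` its component along `b`. Lifting the coordinate by `σ₀` keeps the result
    -- `σ₀`-linear, and on `I′` that component vanishes.
    nextRetraction : Retraction I′
    nextRetraction = record
      { q        = λ x → q x - r x
      ; q-linear = record
        { cong   = λ x≈y → +-cong (q.cong x≈y) (-‿cong (*-congʳ (σ₀H.⟦⟧-cong (φ.cong x≈y))))
        ; +-homo = λ x y → begin
            q (x + y) - r (x + y)            ≈⟨ +-cong (q.+-homo x y) (-‿cong (r-+ x y)) ⟩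
            (q x + q y) - (r x + r y)        ≈⟨ +-congˡ (-‿+-comm (r x) (r y)) ⟨
            (q x + q y) + (- r x - r y)      ≈⟨ interchange (q x) (q y) (- r x) (- r y) ⟩
            (q x - r x) + (q y - r y)        ∎
        ; *-homo = λ k x → begin
            q (σ₀.⟦ k ⟧ * x) - r (σ₀.⟦ k ⟧ * x)     ≈⟨ +-cong (q.*-homo k x) (-‿cong (r-* k x)) ⟩
            σ₀.⟦ k ⟧ * q x - σ₀.⟦ k ⟧ * r x         ≈⟨ x[y-z]≈xy-xz σ₀.⟦ k ⟧ (q x) (r x) ⟨
            σ₀.⟦ k ⟧ * (q x - r x)                  ∎
        }
      -- Congruence modulo `I′` unfolds to membership of `q x - r x` in `I′`.
      ; q∈I      = q∼lifted-φ σ₀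
      ; q-fixes  = λ {x} x∈I′ → begin
          q x - r x      ≈⟨ +-cong (q-fixes (I′⊆I x∈I′)) (-‿cong (r≈0 x∈I′)) ⟩
          x - 0#         ≈⟨ x-0≈x x ⟩
          x              ∎
      }
      where
      open SetoidReasoning setoid
      open CommutativeSemigroupProperties +-commutativeSemigroup using (interchange)

      r : Carrier → Carrier
      r x = σ₀.⟦ φ x ⟧ * b

      r-+ : ∀ x y → r (x + y) ≈ r x + r y
      r-+ x y = trans (*-congʳ (trans (σ₀H.⟦⟧-cong (φ.+-homo x y)) (σ₀H.+-homo (φ x) (φ y))))
                      (distribʳ b σ₀.⟦ φ x ⟧ σ₀.⟦ φ y ⟧)

      r-* : ∀ k x → r (σ₀.⟦ k ⟧ * x) ≈ σ₀.⟦ k ⟧ * r x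
      r-* k x = trans (*-congʳ (trans (σ₀H.⟦⟧-cong (φ.*-homo k x)) (σ₀H.*-homo k (φ x))))
                      (*-assoc σ₀.⟦ k ⟧ σ₀.⟦ φ x ⟧ b)

      x-0≈x : ∀ x → x - 0# ≈ x
      x-0≈x x = trans (+-congˡ -0#≈0#) (+-identityʳ x)

      r≈0 : ∀ {x} → x ∈ I′ → r x ≈ 0#
      r≈0 {x} x∈I′ = trans (*-congʳ (trans (σ₀H.⟦⟧-cong φx∼0) σ₀H.0#-homo)) (zeroˡ b)
        where
        φx∼0 : φ x K.≈ 0#
        φx∼0 = φ-unique (I′.resp-≈
          (trans (sym (q-fixes (I′⊆I x∈I′))) (sym (trans (+-congˡ (-‿cong (zeroˡ b))) (x-0≈x (q x))))) x∈I′)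

    -- Formed with `σ` rather than `σ₀`, because `τ′` is an ST module topology for the action
    -- through `σ`.
    coordinates : Pred Carrier u → Pred Carrier u
    coordinates U k = (σ.⟦ k ⟧ * b) ∈ U ⊕ I′

    coordinates-isSubgroup : ∀ {U} → IsSubgroup +-rawGroup U →
                       IsSubgroup (Group.rawGroup K.+-group) (coordinates U)
    coordinates-isSubgroup U-sub = record
      { resp-≈    = λ k≈l → S.resp-≈ (*-congʳ (σH.⟦⟧-cong k≈l))
      ; ε∈        = S.resp-≈ (sym (trans (*-congʳ σH.0#-homo) (zeroˡ b))) S.ε∈
      ; ∙-closed  = λ {k} {l} k∈ l∈ →
          S.resp-≈ (sym (trans (*-congʳ (σH.+-homo k l)) (distribʳ b _ _))) (S.∙-closed k∈ l∈)
      ; ⁻¹-closed = λ {k} k∈ →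
          S.resp-≈ (sym (trans (*-congʳ (σH.-‿homo k)) (sym (-‿distribˡ-* _ b)))) (S.⁻¹-closed k∈)
      }
      where module S = IsSubgroup (⊕-isSubgroup I′-ideal U-sub)

    W : Pred Carrier u → Pred Carrier u
    W U = φ ⊢ coordinates U

    W-isSubgroup : ∀ {U} → IsSubgroup +-rawGroup U → IsSubgroup +-rawGroup (W U)
    W-isSubgroup U-sub = record
      { resp-≈    = λ x≈y → L.resp-≈ (φ.cong x≈y)
      ; ε∈        = L.resp-≈ (K.sym {φ 0#} {0#} φ.0-homo) L.ε∈
      ; ∙-closed  = λ {x} {y} x∈ y∈ →
          L.resp-≈ (K.sym {φ (x + y)} {φ x + φ y} (φ.+-homo x y)) (L.∙-closed x∈ y∈)
      ; ⁻¹-closed = λ {x} x∈ → L.resp-≈ (K.sym {φ (- x)} {K.- φ x} (φ-neg x)) (L.⁻¹-closed x∈)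
      }
      where
      module L = IsSubgroup (coordinates-isSubgroup U-sub)
      open GroupProperties K.+-group using (inverseˡ-unique)

      φ-neg : ∀ x → φ (- x) K.≈ K.- φ x
      φ-neg x = inverseˡ-unique (φ (- x)) (φ x)
        (K.trans {φ (- x) + φ x} {φ (- x + x)} {0#} (K.sym {φ (- x + x)} {φ (- x) + φ x} (φ.+-homo (- x) x))
          (K.trans {φ (- x + x)} {φ 0#} {0#} (φ.cong (-‿inverseˡ x)) φ.0-homo))

    -- On `I` the retraction is the identity, so `x` is congruent to `σ(φ x) b` modulo `I′`.
    W∩I⊆ : ∀ {U} → IsSubgroup +-rawGroup U → W U ∩ I ⊆ U ⊕ I′
    W∩I⊆ U-sub {x} (x∈W , x∈I) = S.∈-//-cancelʳ
      (⊆-⊕ʳ I′-ideal (IsSubgroup.ε∈ U-sub) (I′.resp-≈ (+-congʳ (q-fixes x∈I)) (q∼lifted-φ σ x))) x∈W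
      where module S = SubgroupProperties +-group (⊕-isSubgroup I′-ideal U-sub)

  -- Openness in the join topology and its descent to the zero ideal.

  module _ (τ′ : Topology setoid) (τ′-isSTModule : IsSTModule ST-K Aσ τ′) where

    -- The subgroups that are open in the join of τ′ and the topology of A.
    record JoinOpen (U : Pred Carrier u) : Set (Level.suc u) where
      field
        isSubgroup : IsSubgroup +-rawGroup U
        O O′       : Pred Carrier u
        O-open     : IsOpen topology O
        O′-open    : IsOpen τ′ O′
        0∈         : 0# ∈ O ∩ O′
        ⊆U         : O ∩ O′ ⊆ U

    -- Quantifies over all join-open subgroups because the descent for `U` uses the hypothesis at
    -- the smaller `U ∩ W U`.
    OpenModulo : Pred Carrier u → Set (Level.suc u)
    OpenModulo I = ∀ U → JoinOpen U → IsOpen topology (U ⊕ I)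

    private
      𝕜-module : Module 𝕜 u u
      𝕜-module = restrict 𝕜 ring structureMap structureMap-isHom (⟨module⟩ {R = ring})

      module A-top = LinearTopologyProperties 𝕜-module isLinear
      module K-top = LinearTopologyProperties _ (STRing.isLinear ST-K)
      module τ′-top = LinearTopologyProperties _ (IsSTModule.isLinearᴹ τ′-isSTModule)

    module _ {I : Pred Carrier u} (I-ideal : IsIdeal ring I) (retraction : Retraction I)
             (step : SimpleStep I) where
      open Descent I-ideal retraction step
      open SimpleStep step

      -- `k ↦ σ(k) b` is continuous into both topologies, so `coordinates U` contains the open
      -- preimage of `O ∩ O′` and is open in `K`; continuity of `φ` does the rest.
      W-open : ∀ {U} → JoinOpen U → IsOpen topology (W U)
      W-open {U} U-open = functional-continuous φ-linear
        (K-top.subgroup-open (coordinates-isSubgroup isSubgroup)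
          (Topology.open-∩ τK (IsSTModule.*ₗ-continuousˡ isSTModule b O-open)
                              (IsSTModule.*ₗ-continuousˡ τ′-isSTModule b O′-open))
          (Topology.open-resp-≈ topology O-open 0≈σ0b (proj₁ 0∈) ,
           Topology.open-resp-≈ τ′ O′-open 0≈σ0b (proj₂ 0∈))
          (λ k∈ → ⊆-⊕ˡ I′-ideal (⊆U k∈)))
        where
        open JoinOpen U-open
        0≈σ0b : 0# ≈ σ.⟦ 0# ⟧ * b
        0≈σ0b = sym (trans (*-congʳ σH.0#-homo) (zeroˡ b))

      -- An element of W ∩ ((U ∩ W) + I) is congruent modulo U to an element of
      -- W ∩ I, and W ∩ I ⊆ U + I′.
      openModulo-step : OpenModulo I → OpenModulo I′
      openModulo-step I-open U U-open = A-top.subgroup-open S-isSubgroup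
        (Topology.open-∩ topology (W-open U-open) (I-open (U ∩ W U) U∩W-open))
        (W.ε∈ , ⊆-⊕ˡ I-ideal (IsSubgroup.ε∈ isSubgroup , W.ε∈))
        (λ (x∈W , v , (v∈U , v∈W) , x-v∈I) →
          S.∈-//-cancelʳ (W∩I⊆ isSubgroup (W.//-closed x∈W v∈W , x-v∈I)) (⊆-⊕ˡ I′-ideal v∈U))
        where
        open JoinOpen U-open
        S-isSubgroup = ⊕-isSubgroup I′-ideal isSubgroup
        module S = SubgroupProperties +-group S-isSubgroup
        module W where
          open IsSubgroup (W-isSubgroup isSubgroup) public
          open SubgroupProperties +-group (W-isSubgroup isSubgroup) public
        U∩W-open : JoinOpen (U ∩ W U)
        U∩W-open = record
          { isSubgroup = ∩-isSubgroup isSubgroup (W-isSubgroup isSubgroup)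
          ; O-open     = Topology.open-∩ topology O-open (W-open U-open)
          ; O′-open    = O′-open
          ; 0∈         = (proj₁ 0∈ , W.ε∈) , proj₂ 0∈
          ; ⊆U         = λ ((x∈O , x∈W) , x∈O′) → ⊆U (x∈O , x∈O′) , x∈W
          }

    joinOpen⇒open : ∀ {U} → JoinOpen U → IsOpen topology U
    joinOpen⇒open {U} U-open =
      let
        -- The descent starts at `I = A`, where `U + I = A` is open and the identity is a
        -- retraction.
        (I , I-ideal , (I-open , retraction) , I-minimal) =
          minimalIdeal (λ I → OpenModulo I × Retraction I) whole-isIdeal (whole-open , whole-retraction)

        I⊆0 : ∀ {z} → z ∈ I → z ≈ 0#
        I⊆0 z∈I = dne λ z≉0 →
          let step = simpleStep I-ideal z∈I z≉0
              open SimpleStep step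
          in b∉I′ (I-minimal I′ I′-ideal
               (openModulo-step I-ideal retraction step I-open , Descent.nextRetraction I-ideal retraction step)
               I′⊆I b∈I)
      in Topology.open-resp-≐ topology
           ((λ (v , v∈U , x-v∈I) → U.resp-≈ (sym (x∙y⁻¹≈ε⇒x≈y _ v (I⊆0 x-v∈I))) v∈U) , ⊆-⊕ˡ I-ideal)
           (I-open U U-open)
      where
      module U = IsSubgroup (JoinOpen.isSubgroup U-open)

      whole-isIdeal : IsIdeal ring (λ _ → ⊤)
      whole-isIdeal = record
        { resp-≈ = λ _ _ → tt ; 0∈ = tt ; +-closed = λ _ _ → tt ; *ₗ-closed = λ _ _ → tt }

      whole-open : OpenModulo (λ _ → ⊤)
      whole-open V V-open = Topology.open-resp-≐ topology
        ((λ _ → 0# , IsSubgroup.ε∈ (JoinOpen.isSubgroup V-open) , tt) , (λ _ → tt))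
        (Topology.open-whole topology)

      whole-retraction : Retraction (λ _ → ⊤)
      whole-retraction = record
        { q        = λ x → x
        ; q-linear = record { cong = λ x≈y → x≈y ; +-homo = λ _ _ → refl ; *-homo = λ _ _ → refl }
        ; q∈I      = λ _ → tt
        ; q-fixes  = λ _ → refl
        }

    -- A `τ′`-open set is a union of cosets of `τ′`-open submodules, and each such submodule is
    -- join-open with `O` the whole ring.
    finer : FinerThan topology τ′
    finer oU = A-top.open-local λ {x} x∈U →
      let (N , N-sub , oN , x+N⊆U) = τ′-top.cosetBasis oU x∈U
          N-joinOpen : JoinOpen N
          N-joinOpen = record
            { isSubgroup = submodule⇒subgroup _ N-sub
            ; O-open     = Topology.open-whole topology
            ; O′-open    = oN
            ; 0∈         = tt , IsSubmodule.0∈ N-sub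
            ; ⊆U         = proj₂
            }
      in _ , A-top.translate-open (- x) (joinOpen⇒open N-joinOpen)
           , IsSubmodule.resp-≈ N-sub (sym (-‿inverseˡ x)) (IsSubmodule.0∈ N-sub)
           , x+N⊆U

corollary0p14 : (∀ (ℓ : Level) → ExcludedMiddle ℓ) →
    ∀ {u : Level} (𝕜 : CommutativeRing u u) → IsNonzero 𝕜 →
    (A : STRing 𝕜) → IsArtinian (STRing.ring A) →
    (local : IsLocal (STRing.ring A)) →
    (τK : Topology (CommutativeRing.setoid (Residue.K A local))) →
    (fine : Residue.IsFineOnK A local τK) →
    ∃ (Liftings.IsPrecise A local τK fine) →
    (σ : Liftings.Lifting A local τK fine) → Liftings.IsPrecise A local τK fine σ
corollary0p14 em 𝕜 _ A artinian local τK fine (σ₀ , precise) σ =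
  Comparison.isSTModule em 𝕜 A artinian local τK fine σ₀ precise σ ,
  Comparison.finer em 𝕜 A artinian local τK fine σ₀ precise σ
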